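{- Let $\phi$ be a first order sentence in negation normal form. There exist a strategy $\sigma_0$ of Abelard in the model existence game $\mathrm{MEG}(\phi)$ (an ``enumeration strategy'') and a mapping $\Psi$ such that for every strategy $\tau$ of Eloise in $\mathrm{MEG}(\phi)$, the play of $\mathrm{MEG}(\phi)$ in which Abelard follows $\sigma_0$ and Eloise follows $\tau$ determines a unique structure $M(\tau)$ (whose domain consists of interpretations of the constants $c_n$), and $\Psi(\tau)$ is a strategy of Eloise in the evaluation game $G(M(\tau),\phi)$. If $\tau$ is a winning strategy of Eloise in $\mathrm{MEG}(\phi)$, then $\Psi(\tau)$ is a winning strategy of Eloise in $G(M(\tau),\phi)$.
   Context: An assignment into a set $X$ is a map from a finite set of variables into $X$; $s(a/x)$ denotes the assignment agreeing with $s$ except that it sends $x$ to $a$. A formula is in negation normal form if negation occurs only in front of atomic formulas; the connectives are $\neg,\wedge,\vee,\forall,\exists$. Evaluation game $G(M,\phi)$: players Abelard and Eloise. Positions are pairs $(\psi,s)$ with $\psi$ a subformula of $\phi$ and $s$ an assignment into $M$; initial position $(\phi,\emptyset)$. At $(\psi,s)$: if $\psi$ is a literal, the game ends and Eloise wins iff $s$ satisfies $\psi$ in $M$; if $\psi=\psi_0\wedge\psi_1$, Abelard chooses the next position $(\psi_0,s)$ or $(\psi_1,s)$; if $\psi=\psi_0\vee\psi_1$, Eloise chooses it; if $\psi=\forall x\theta$, Abelard chooses $a\in M$ and the next position is $(\theta,s(a/x))$; if $\psi=\exists x\theta$, Eloise chooses $a\in M$ and the next position is $(\theta,s(a/x))$.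 A strategy is winning if its player wins every play following it. Model existence game $\mathrm{MEG}(\phi)$: let $C=\{c_0,c_1,\ldots\}$ be a countable set of new distinct constant symbols; a $C$-assignment is an assignment into $C$. Positions are finite sets $S$ of pairs $(\psi,s)$ with $\psi$ a subformula of $\phi$ and $s$ a $C$-assignment; the initial position is $\{(\phi,\emptyset)\}$. At each move, given the position $S$, Abelard selects a pair in $S$ and one of the following applies: if $(\psi_0\wedge\psi_1,s)\in S$, Abelard may decide that the next position is $S\cup\{(\psi_0,s)\}$ or $S\cup\{(\psi_1,s)\}$; if $(\psi_0\vee\psi_1,s)\in S$, Abelard may demand that Eloise choose whether the next position is $S\cup\{(\psi_0,s)\}$ or $S\cup\{(\psi_1,s)\}$; if $(\forall x\theta,s)\in S$, Abelard may choose $n\in\mathbb N$ and the next position is $S\cup\{(\theta,s(c_n/x))\}$; if $(\exists x\theta,s)\in S$, Abelard may demand that Eloise choose some $c_n$, and the next position is $S\cup\{(\theta,s(c_n/x))\}$. Abelard wins if at some point the position contains both $(\psi,s)$ and $(\neg\psi,s')$ with $\psi$ atomic and $s(x)=s'(x)$ for all variables $x$ of $\psi$. Otherwise (the game continuing for infinitely many moves) Eloise wins.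
   Formalization: Abelard wins when the two literals agree after substituting constants (P(x) and ¬P(y) clash if s(x)=s'(y)), since otherwise ∀xP(x)∧∃y¬P(y) refutes the claim; the vocabulary is relational without identity, function or constant symbols, which the games do not treat. -}

module Defs where

open import Data.Empty using (⊥)
open import Data.List.Base using (List; []; _∷_)
open import Data.List.Membership.Propositional using (_∈_)
open import Data.Maybe.Base using (Maybe; just; nothing)
open import Data.Nat.Base using (ℕ; zero; suc)
open import Data.Nat.Properties using (_≟_)
open import Data.Product.Base using (Σ; Σ-syntax; ∃-syntax; _×_; _,_; proj₁; proj₂)
open import Data.Sum.Base using (_⊎_)
open import Data.Unit.Base using (⊤)
open import Data.Vec.Base using (Vec; map)
import Data.Vec.Membership.Propositional as VecMembership
open import Data.Vec.Relation.Binary.Pointwise.Inductive using (Pointwise)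
open import Function.Bundles using (_⇔_)
open import Function.Definitions using (Bijective)
open import Relation.Binary.PropositionalEquality using (_≡_; _≢_)
open import Relation.Nullary using (¬_; yes; no)

-- Relational vocabularies; identity is not a logical symbol.  The winning
-- condition of the model existence game says nothing about identity, constant
-- or function symbols.

record Vocabulary : Set₁ where
  field
    Rel   : Set
    arity : Rel → ℕ

open Vocabulary public

Var : Set
Var = ℕ

data Atom (V : Vocabulary) : Set where
  _·_ : (R : Rel V) → Vec Var (arity V R) → Atom V

data Literal (V : Vocabulary) : Set where
  pos neg : Atom V → Literal V

-- Formulas in negation normal form.

infixr 6 _∧_
infixr 5 _∨_

data Formula (V : Vocabulary) : Set where
  lit     : Literal V → Formula V
  _∧_ _∨_ : Formula V → Formula V → Formula V
  all ex  : Var → Formula V → Formula V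

module _ {V : Vocabulary} where

  _FreeIn_ : Var → Formula V → Set
  x FreeIn lit (pos (R · xs)) = x VecMembership.∈ xs
  x FreeIn lit (neg (R · xs)) = x VecMembership.∈ xs
  x FreeIn (ψ₀ ∧ ψ₁)          = x FreeIn ψ₀ ⊎ x FreeIn ψ₁
  x FreeIn (ψ₀ ∨ ψ₁)          = x FreeIn ψ₀ ⊎ x FreeIn ψ₁
  x FreeIn all y θ            = x ≢ y × x FreeIn θ
  x FreeIn ex y θ             = x ≢ y × x FreeIn θ

  Sentence : Formula V → Set
  Sentence φ = ∀ x → ¬ (x FreeIn φ)

-- A finite list of bindings stands for the finite partial map computed by
-- lookup: the first binding of a variable shadows later ones.

Assignment : Set → Set
Assignment X = List (Var × X)

∅ : {X : Set} → Assignment X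
∅ = []

_[_/_] : {X : Set} → Assignment X → X → Var → Assignment X
s [ a / x ] = (x , a) ∷ s

lookup : {X : Set} → Assignment X → Var → Maybe X
lookup []            x = nothing
lookup ((y , a) ∷ s) x with x ≟ y
... | yes _ = just a
... | no  _ = lookup s x

_sends_to_ : {X : Set} {n : ℕ} → Assignment X → Vec Var n → Vec X n → Set
s sends xs to as = Pointwise (λ x a → lookup s x ≡ just a) xs as

record Structure (V : Vocabulary) : Set₁ where
  field
    Dom : Set
    rel : (R : Rel V) → Vec Dom (arity V R) → Set

open Structure public

-- An assignment that is undefined at some variable of a literal satisfies
-- neither that literal nor its negation.

_,_⊨_ : {V : Vocabulary} (M : Structure V) → Assignment (Dom M) → Literal V → Set
M , s ⊨ pos (R · xs) = ∃[ as ] s sends xs to as × rel M R as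
M , s ⊨ neg (R · xs) = ∃[ as ] s sends xs to as × ¬ rel M R as

data Side : Set where
  left right : Side

-- The choices attached to a pair (ψ , s) are the same in both games: at each
-- pair at most one of the players has a genuine choice, the other one's choice
-- being tt.

Pair : Vocabulary → Set → Set
Pair V X = Formula V × Assignment X

module _ {V : Vocabulary} (X : Set) where

  AbelardChoice : Formula V → Set
  AbelardChoice (lit _)   = ⊤
  AbelardChoice (_ ∧ _)   = Side
  AbelardChoice (_ ∨ _)   = ⊤
  AbelardChoice (all _ _) = X
  AbelardChoice (ex _ _)  = ⊤

  EloiseChoice : Formula V → Set
  EloiseChoice (lit _)   = ⊤
  EloiseChoice (_ ∧ _)   = ⊤
  EloiseChoice (_ ∨ _)   = Side
  EloiseChoice (all _ _) = ⊤
  EloiseChoice (ex _ _)  = X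

  successor : (ψ : Formula V) → Assignment X → AbelardChoice ψ → EloiseChoice ψ → Pair V X
  successor (lit ℓ)   s _     _     = lit ℓ , s
  successor (ψ₀ ∧ ψ₁) s left  _     = ψ₀ , s
  successor (ψ₀ ∧ ψ₁) s right _     = ψ₁ , s
  successor (ψ₀ ∨ ψ₁) s _     left  = ψ₀ , s
  successor (ψ₀ ∨ ψ₁) s _     right = ψ₁ , s
  successor (all x θ) s a     _     = θ , s [ a / x ]
  successor (ex x θ)  s _     a     = θ , s [ a / x ]

Compound : {V : Vocabulary} → Formula V → Set
Compound (lit _)   = ⊥
Compound (_ ∧ _)   = ⊤
Compound (_ ∨ _)   = ⊤
Compound (all _ _) = ⊤
Compound (ex _ _)  = ⊤

-- Strategies in both games are functions of the whole history.  Histories start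
-- at the initial position, so only subformulas of φ ever occur in them.

module EvaluationGame {V : Vocabulary} (M : Structure V) (φ : Formula V) where

  Position : Set
  Position = Pair V (Dom M)

  data History : Position → Set where
    start : History (φ , ∅)
    move  : ∀ {ψ s} → History (ψ , s) → Compound ψ →
            (a : AbelardChoice (Dom M) ψ) (e : EloiseChoice (Dom M) ψ) →
            History (successor (Dom M) ψ s a e)

  EloiseStrategy : Set
  EloiseStrategy = ∀ {ψ s} → History (ψ , s) → AbelardChoice (Dom M) ψ → EloiseChoice (Dom M) ψ

  data Follows (σ : EloiseStrategy) : ∀ {p} → History p → Set where
    start : Follows σ start
    move  : ∀ {ψ s} {h : History (ψ , s)} → Follows σ h → (k : Compound ψ) →
            (a : AbelardChoice (Dom M) ψ) → Follows σ (move h k a (σ h a))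

  Winning : EloiseStrategy → Set
  Winning σ = ∀ {ℓ s} (h : History (lit ℓ , s)) → Follows σ h → M , s ⊨ ℓ

-- The new constants c₀, c₁, ….

data C : Set where
  c : ℕ → C

module ModelExistenceGame {V : Vocabulary} (φ : Formula V) where

  -- A list stands for the finite set of its members.

  Position : Set
  Position = List (Pair V C)

  -- The membership proof is irrelevant, so that strategies cannot depend on
  -- which occurrence of a pair in the list is meant.

  record AbelardMove (S : Position) : Set where
    constructor select
    field
      {ψ}     : Formula V
      {s}     : Assignment C
      .member : (ψ , s) ∈ S
      choice  : AbelardChoice C ψ

  open AbelardMove public

  EloiseAnswer : ∀ {S} → AbelardMove S → Set
  EloiseAnswer m = EloiseChoice C (ψ m)

  -- Selecting a literal leaves the set S unchanged.

  next : ∀ {S} (m : AbelardMove S) → EloiseAnswer m → Position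
  next {S} m e = successor C (ψ m) (s m) (choice m) e ∷ S

  data History : Position → Set where
    start : History ((φ , ∅) ∷ [])
    round : ∀ {S} → History S → (m : AbelardMove S) (e : EloiseAnswer m) → History (next m e)

  AbelardStrategy : Set
  AbelardStrategy = ∀ {S} → History S → AbelardMove S

  EloiseStrategy : Set
  EloiseStrategy = ∀ {S} → History S → (m : AbelardMove S) → EloiseAnswer m

  State : Set
  State = Σ Position History

  data _⟶_ : State → State → Set where
    step : ∀ {S} {h : History S} (m : AbelardMove S) (e : EloiseAnswer m) →
           (S , h) ⟶ (next m e , round h m e)

  record Play : Set where
    field
      state   : ℕ → State
      initial : state zero ≡ (_ , start)
      steps   : ∀ n → state n ⟶ state (suc n)

    position : ℕ → Position
    position n = proj₁ (state n)

    history : ∀ n → History (position n)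
    history n = proj₂ (state n)

  open Play public

  data EloiseStep (τ : EloiseStrategy) : ∀ {p q} → p ⟶ q → Set where
    step : ∀ {S} {h : History S} (m : AbelardMove S) → EloiseStep τ (step {h = h} m (τ h m))

  EloiseFollows : EloiseStrategy → Play → Set
  EloiseFollows τ p = ∀ n → EloiseStep τ (steps p n)

  -- The atomic sentences obtained from the two atoms by substituting the
  -- constants coincide.  The atoms themselves may differ in their variables:
  -- P(x) under x ↦ c₀ clashes with ¬P(y) under y ↦ c₀.

  Clash : Position → Set
  Clash S = ∃[ R ] ∃[ xs ] ∃[ ys ] ∃[ s ] ∃[ s′ ] ∃[ cs ]
    (lit (pos (R · xs)) , s) ∈ S × (lit (neg (R · ys)) , s′) ∈ S ×
    s sends xs to cs × s′ sends ys to cs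

  AbelardWins : Play → Set
  AbelardWins p = ∃[ n ] Clash (position p n)

  EloiseWins : Play → Set
  EloiseWins p = ¬ AbelardWins p

  Winning : EloiseStrategy → Set
  Winning τ = ∀ p → EloiseFollows τ p → EloiseWins p

  stateOf : AbelardStrategy → EloiseStrategy → ℕ → State
  stateOf σ τ zero    = _ , start
  stateOf σ τ (suc n) with stateOf σ τ n
  ... | _ , h = _ , round h (σ h) (τ h (σ h))

  playOf : AbelardStrategy → EloiseStrategy → Play
  playOf σ τ = record
    { state   = stateOf σ τ
    ; initial = _≡_.refl
    ; steps   = λ n → step (σ (proj₂ (stateOf σ τ n))) _
    }

  -- Against every strategy of Eloise, each move that becomes available to
  -- Abelard is made at some stage.

  Enumeration : AbelardStrategy → Set
  Enumeration σ = ∀ (τ : EloiseStrategy) n ψ₀ s₀ →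
    (ψ₀ , s₀) ∈ position (playOf σ τ) n → (a : AbelardChoice C ψ₀) →
    ∃[ k ] let m = σ (history (playOf σ τ) k) in
      _≡_ {A = Σ[ p ∈ Pair V C ] AbelardChoice C (proj₁ p)}
          ((ψ m , s m) , choice m) ((ψ₀ , s₀) , a)

  -- Identity not being in the language, distinct constants denote distinct
  -- elements.

  record DeterminedBy (p : Play) (M : Structure V) : Set where
    field
      ⟦_⟧       : C → Dom M
      bijective : Bijective _≡_ _≡_ ⟦_⟧
      relations : ∀ R (cs : Vec C (arity V R)) →
        rel M R (map ⟦_⟧ cs) ⇔
        (∃[ n ] ∃[ xs ] ∃[ s ] (lit (pos (R · xs)) , s) ∈ position p n × s sends xs to cs)

  record _≅_ {p M N} (d : DeterminedBy p M) (e : DeterminedBy p N) : Set where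
    open DeterminedBy
    field
      to        : Dom M → Dom N
      bijective : Bijective _≡_ _≡_ to
      constants : ∀ a → to (⟦ d ⟧ a) ≡ ⟦ e ⟧ a
      relations : ∀ R as → rel M R as ⇔ rel N R (map to as)

  UniquelyDeterminedBy : Play → Structure V → Set₁
  UniquelyDeterminedBy p M =
    Σ[ d ∈ DeterminedBy p M ] (∀ (N : Structure V) (e : DeterminedBy p N) → d ≅ e)

{-# OPTIONS --safe #-}

-- Abelard's enumeration strategy sees the pairs of a position in the order in
-- which they were added, and at stage n attends to pair number i with choice
-- number j, where (i , j) is the n-th point of Cantor's walk through ℕ × ℕ.
-- Thus in the play against τ every available move is eventually made, and the
-- set H of all pairs that ever occur is a Hintikka set.  M(τ) has the constants
-- as its elements and the positive literals in H as its diagram.  In the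
-- evaluation game on M(τ) Eloise keeps the current pair in H, copying the answer
-- of τ at a stage where Abelard made the corresponding move.  A play ends at a
-- literal in H, which is true in M(τ) as long as H contains no clash.

module Submission where

open import Data.List.Membership.Propositional using (_∈_)
open import Data.List.Relation.Unary.Any using (here; there)
open import Data.Maybe.Base using (Maybe; just; nothing)
open import Data.Nat.Base using (ℕ; zero; suc; _+_; _∸_; _≤_; z≤n; s≤s)
open import Data.Nat.Properties as ℕ using (_≤?_)
open import Data.Product.Base using (Σ-syntax; ∃-syntax; _×_; _,_; proj₁; proj₂; map₂)
open import Data.Sum.Base using (inj₁; inj₂)
open import Data.Unit.Base using (tt)
import Data.Unit.Properties as ⊤
open import Data.Vec.Base using (Vec; []; _∷_)
open import Data.Vec.Properties using (map-id)
open import Data.Vec.Relation.Binary.Pointwise.Inductive using ([]; _∷_)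
import Data.Vec.Membership.Propositional as Vec
import Data.Vec.Relation.Unary.Any as VecAny
open import Function.Base using (id; _∘_)
open import Function.Bundles using (_⇔_)
import Function.Construct.Identity as Identity
import Function.Construct.Symmetry as Symmetry
open import Relation.Binary.Definitions using (DecidableEquality)
open import Relation.Binary.PropositionalEquality
open import Relation.Nullary using (yes; no; contradiction)
open import Relation.Nullary.Decidable using (map′)
open import Defs

-- Cantor's walk through pairs of natural numbers.

cantorStep : ℕ × ℕ → ℕ × ℕ
cantorStep (zero  , b) = suc b , zero
cantorStep (suc a , b) = a , suc b

cantor : ℕ → ℕ × ℕ
cantor zero    = zero , zero
cantor (suc n) = cantorStep (cantor n)

-- The walk runs along each antidiagonal from `(d , 0)` to `(0 , d)`. Going backwards lowers `b`; at
-- `b = 0` it returns to the end of the previous diagonal and lowers `d`. The recursion is thus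
-- lexicographic in `d` and `b`.
cantor-surjective-on-diagonal : ∀ d b a → a + b ≡ d → ∃[ n ] cantor n ≡ (a , b)
cantor-surjective-on-diagonal d (suc b) a a+b≡d
  with cantor-surjective-on-diagonal d b (suc a) (trans (sym (ℕ.+-suc a b)) a+b≡d)
... | n , eq = suc n , cong cantorStep eq
cantor-surjective-on-diagonal _ zero zero _ = zero , refl
cantor-surjective-on-diagonal (suc d) zero (suc a) a+0≡d
  with cantor-surjective-on-diagonal d d zero refl
... | n , eq = suc n , trans (cong cantorStep eq)
                 (cong (_, zero) (trans (sym a+0≡d) (ℕ.+-identityʳ (suc a))))

cantor-surjective : ∀ a b → ∃[ n ] cantor n ≡ (a , b)
cantor-surjective a b = cantor-surjective-on-diagonal (a + b) b a refl

cantorStep-sum : (p : ℕ × ℕ) → let (a , b) = p ; (a′ , b′) = cantorStep p in a′ + b′ ≤ suc (a + b)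
cantorStep-sum (zero  , b) = ℕ.≤-reflexive (ℕ.+-identityʳ (suc b))
cantorStep-sum (suc a , b) = ℕ.≤-trans (ℕ.≤-reflexive (ℕ.+-suc a b)) (ℕ.n≤1+n (suc a + b))

cantor-sum : ∀ n → let (a , b) = cantor n in a + b ≤ n
cantor-sum zero    = z≤n
cantor-sum (suc n) = ℕ.≤-trans (cantorStep-sum (cantor n)) (s≤s (cantor-sum n))

-- Ensures that the pair attended to at stage `n` has already been added.
cantor-proj₁-≤ : ∀ n → proj₁ (cantor n) ≤ n
cantor-proj₁-≤ n = ℕ.≤-trans (ℕ.m≤m+n _ _) (cantor-sum n)

-- Comparing and enumerating the players' choices.

_≟-Side_ : DecidableEquality Side
left  ≟-Side left  = yes refl
left  ≟-Side right = no λ ()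
right ≟-Side left  = no λ ()
right ≟-Side right = yes refl

_≟-C_ : DecidableEquality C
c m ≟-C c n = map′ (cong c) (λ { refl → refl }) (m ℕ.≟ n)

module _ {V : Vocabulary} where

  ≟-EloiseChoice : (ψ : Formula V) → DecidableEquality (EloiseChoice C ψ)
  ≟-EloiseChoice (lit _)   = ⊤._≟_
  ≟-EloiseChoice (_ ∧ _)   = ⊤._≟_
  ≟-EloiseChoice (_ ∨ _)   = _≟-Side_
  ≟-EloiseChoice (all _ _) = ⊤._≟_
  ≟-EloiseChoice (ex _ _)  = _≟-C_

  defaultEloiseChoice : (ψ : Formula V) → EloiseChoice C ψ
  defaultEloiseChoice (lit _)   = tt
  defaultEloiseChoice (_ ∧ _)   = tt
  defaultEloiseChoice (_ ∨ _)   = left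
  defaultEloiseChoice (all _ _) = tt
  defaultEloiseChoice (ex _ _)  = c 0

  abelardChoice : (ψ : Formula V) → ℕ → AbelardChoice C ψ
  abelardChoice (lit _)   _       = tt
  abelardChoice (_ ∧ _)   zero    = left
  abelardChoice (_ ∧ _)   (suc _) = right
  abelardChoice (_ ∨ _)   _       = tt
  abelardChoice (all _ _) n       = c n
  abelardChoice (ex _ _)  _       = tt

  abelardChoice-surjective : (ψ : Formula V) (a : AbelardChoice C ψ) →
                             ∃[ n ] abelardChoice ψ n ≡ a
  abelardChoice-surjective (lit _)   _     = 0 , refl
  abelardChoice-surjective (_ ∧ _)   left  = 0 , refl
  abelardChoice-surjective (_ ∧ _)   right = 1 , refl
  abelardChoice-surjective (_ ∨ _)   _     = 0 , refl
  abelardChoice-surjective (all _ _) (c n) = n , refl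
  abelardChoice-surjective (ex _ _)  _     = 0 , refl

  -- Assignments defined on the free variables.

  Covers : {X : Set} → Pair V X → Set
  Covers (ψ , s) = ∀ x → x FreeIn ψ → ∃[ a ] lookup s x ≡ just a

  lookup-update : {X : Set} (s : Assignment X) (a : X) (x y : Var) →
                  (y ≢ x → ∃[ b ] lookup s y ≡ just b) →
                  ∃[ b ] lookup (s [ a / x ]) y ≡ just b
  lookup-update s a x y defined with y ℕ.≟ x
  ... | yes _  = a , refl
  ... | no y≢x = defined y≢x

  covers-successor : {X : Set} (ψ : Formula V) {s : Assignment X}
                     (a : AbelardChoice X ψ) (e : EloiseChoice X ψ) →
                     Covers (ψ , s) → Covers (successor X ψ s a e)
  covers-successor (lit _)   a     e     cov x x∈ = cov x x∈
  covers-successor (_ ∧ _)   left  e     cov x x∈ = cov x (inj₁ x∈)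
  covers-successor (_ ∧ _)   right e     cov x x∈ = cov x (inj₂ x∈)
  covers-successor (_ ∨ _)   a     left  cov x x∈ = cov x (inj₁ x∈)
  covers-successor (_ ∨ _)   a     right cov x x∈ = cov x (inj₂ x∈)
  covers-successor (all y _) a     e     cov x x∈ = lookup-update _ a y x λ x≢y → cov x (x≢y , x∈)
  covers-successor (ex y _)  a     e     cov x x∈ = lookup-update _ e y x λ x≢y → cov x (x≢y , x∈)

  -- Vacuous at the start, since a sentence has no free variables; afterwards each quantifier move
  -- assigns a value to the variable it frees.
  covers-history : (M : Structure V) {φ : Formula V} → Sentence φ →
                   ∀ {p} → EvaluationGame.History M φ p → Covers p
  covers-history M sentence EvaluationGame.start x x∈ = contradiction x∈ (sentence x)
  covers-history M sentence (EvaluationGame.move {ψ} h _ a e) =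
    covers-successor ψ a e (covers-history M sentence h)

sends-total : {X : Set} (s : Assignment X) {n : ℕ} (xs : Vec Var n) →
              (∀ x → x Vec.∈ xs → ∃[ a ] lookup s x ≡ just a) →
              ∃[ as ] s sends xs to as
sends-total s []       _       = [] , []
sends-total s (x ∷ xs) defined
  with defined x (VecAny.here refl) | sends-total s xs (λ y → defined y ∘ VecAny.there)
... | a , eq | as , eqs = a ∷ as , eq ∷ eqs

-- The enumeration strategy of Abelard.

module EnumerationStrategy {V : Vocabulary} (φ : Formula V) where

  open ModelExistenceGame φ

  stage : ∀ {S} → History S → ℕ
  stage start         = 0
  stage (round h _ _) = suc (stage h)

  -- The pair added at stage i; a junk value for i > stage h.
  entry : ∀ {S} → History S → ℕ → Σ[ p ∈ Pair V C ] p ∈ S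
  entry start         i = _ , here refl
  entry (round h m e) i with i ≤? stage h
  ... | yes _ = map₂ there (entry h i)
  ... | no  _ = _ , here refl

  entry-old : ∀ {S} (h : History S) m e {i} → i ≤ stage h →
              proj₁ (entry (round h m e) i) ≡ proj₁ (entry h i)
  entry-old h m e {i} i≤ with i ≤? stage h
  ... | yes _ = refl
  ... | no i≰ = contradiction i≤ i≰

  entry-new : ∀ {S} (h : History S) m e →
              proj₁ (entry (round h m e) (suc (stage h))) ≡
              successor C (ψ m) (s m) (choice m) e
  entry-new h m e with suc (stage h) ≤? stage h
  ... | yes lt = contradiction lt (ℕ.<-irrefl refl)
  ... | no _   = refl

  entry-surjective : ∀ {S p} (h : History S) → p ∈ S →
                     ∃[ i ] i ≤ stage h × proj₁ (entry h i) ≡ p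
  entry-surjective start         (here refl) = 0 , z≤n , refl
  entry-surjective (round h m e) (here refl) = suc (stage h) , ℕ.≤-refl , entry-new h m e
  entry-surjective (round h m e) (there p∈)  with entry-surjective h p∈
  ... | i , i≤ , eq = i , ℕ.m≤n⇒m≤1+n i≤ , trans (entry-old h m e i≤) eq

  moveAt : ∀ {S} → History S → ℕ × ℕ → AbelardMove S
  moveAt h (i , j) = select (proj₂ (entry h i)) (abelardChoice (proj₁ (proj₁ (entry h i))) j)

  enumerationStrategy : AbelardStrategy
  enumerationStrategy h = moveAt h (cantor (stage h))

  module _ (τ : EloiseStrategy) where

    play : Play
    play = playOf enumerationStrategy τ

    stage-history : ∀ n → stage (history play n) ≡ n
    stage-history zero    = refl
    stage-history (suc n) = cong suc (stage-history n)

    -- Written with `d + i` so that the later history unfolds to a `round` over the earlier one, to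
    -- which `entry-old` applies.
    entry-stable-+ : ∀ d {i} → proj₁ (entry (history play (d + i)) i) ≡
                               proj₁ (entry (history play i) i)
    entry-stable-+ zero        = refl
    entry-stable-+ (suc d) {i} = trans
      (entry-old (history play (d + i)) _ _
        (ℕ.≤-trans (ℕ.m≤n+m i d) (ℕ.≤-reflexive (sym (stage-history (d + i))))))
      (entry-stable-+ d)

    entry-stable : ∀ {i n} → i ≤ n → proj₁ (entry (history play n) i) ≡
                                     proj₁ (entry (history play i) i)
    entry-stable {i} {n} i≤n =
      subst (λ m → proj₁ (entry (history play m) i) ≡ _) (ℕ.m∸n+n≡m i≤n) (entry-stable-+ (n ∸ i))

    position-+ : ∀ d {n p} → p ∈ position play n → p ∈ position play (d + n)
    position-+ zero    p∈ = p∈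
    position-+ (suc d) p∈ = there (position-+ d p∈)

    eloiseFollows : EloiseFollows τ play
    eloiseFollows n = step _

  enumeration : Enumeration enumerationStrategy
  enumeration τ n ψ₀ s₀ p∈ a
    with entry-surjective (history (play τ) n) p∈ | abelardChoice-surjective ψ₀ a
  ... | i , i≤stage , entry≡p | j , refl with cantor-surjective i j
  ... | k , cantor≡ = k , (begin
    move-of (cantor (stage (history (play τ) k)))  ≡⟨ cong (move-of ∘ cantor) (stage-history τ k) ⟩
    move-of (cantor k)                             ≡⟨ cong move-of cantor≡ ⟩
    move-of (i , j)                                ≡⟨ cong (λ p → p , abelardChoice (proj₁ p) j) entry≡ ⟩
    ((ψ₀ , s₀) , abelardChoice ψ₀ j)               ∎)
    where
    open ≡-Reasoning
    move-of : ℕ × ℕ → Σ[ p ∈ Pair V C ] AbelardChoice C (proj₁ p)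
    move-of ij = let m = moveAt (history (play τ) k) ij in (ψ m , s m) , choice m

    entry≡ : proj₁ (entry (history (play τ) k) i) ≡ (ψ₀ , s₀)
    -- Stages `k` and `n` are compared through stage `i`, when pair number `i` was added: `i ≤ k` by
    -- the bound on the walk, and `i ≤ n` because the pair is present at stage `n`.
    entry≡ = trans (entry-stable τ (subst (_≤ k) (cong proj₁ cantor≡) (cantor-proj₁-≤ k)))
            (trans (sym (entry-stable τ (subst (i ≤_) (stage-history τ n) i≤stage)))
                   entry≡p)

-- The model read off from the play against `τ`.

module HintikkaModel {V : Vocabulary} (φ : Formula V) (τ : ModelExistenceGame.EloiseStrategy φ) where

  open ModelExistenceGame φ
  open EnumerationStrategy φ

  Occurs : Pair V C → Set
  Occurs p = ∃[ n ] p ∈ position (play τ) n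

  model : Structure V
  model = record
    { Dom = C
    ; rel = λ R cs → ∃[ n ] ∃[ xs ] ∃[ s ]
              (lit (pos (R · xs)) , s) ∈ position (play τ) n × s sends xs to cs
    }

  determined : DeterminedBy (play τ) model
  determined = record
    { ⟦_⟧       = id
    ; bijective = Identity.bijective _≡_
    ; relations = λ R cs → subst (λ as → rel model R as ⇔ rel model R cs) (sym (map-id cs))
                             (Identity.⇔-id _)
    }

  -- Both structures are governed by the same condition on the play, so the interpretation of the
  -- constants in `N` is itself the isomorphism.
  determined-unique : ∀ N (e : DeterminedBy (play τ) N) → determined ≅ e
  determined-unique N e = record
    { to        = ⟦_⟧
    ; bijective = bijective
    ; constants = λ _ → refl
    ; relations = λ R cs → Symmetry.⇔-sym (relations R cs)
    }
    where open DeterminedBy e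

  -- Eloise's strategy in the evaluation game.

  module G = EvaluationGame model φ

  -- Indexed by pair and choice together, so that the single equation from `enumeration` transports
  -- both.
  Response : Σ[ p ∈ Pair V C ] AbelardChoice C (proj₁ p) → Set
  Response ((ψ , s) , a) = Σ[ e ∈ EloiseChoice C ψ ] Occurs (successor C ψ s a e)

  respond : ∀ {ψ s} → Occurs (ψ , s) → (a : AbelardChoice C ψ) → Response ((ψ , s) , a)
  respond {ψ} {s} (n , p∈) a with enumeration τ n ψ s p∈ a
  ... | k , eq = subst Response eq (τ (history (play τ) k) _ , suc k , here refl)

  -- Off the plays that follow the strategy the current pair need not occur, which
  -- is recorded by nothing.
  answer : ∀ {ψ s} → Maybe (Occurs (ψ , s)) → AbelardChoice C ψ → EloiseChoice C ψ
  answer (just o)    a = proj₁ (respond o a)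
  answer {ψ} nothing a = defaultEloiseChoice ψ

  -- A history may record an answer `e` other than the one copied from `τ`. The two are compared,
  -- and after a first disagreement tracking stops for good.
  extend : ∀ {ψ s} → Maybe (Occurs (ψ , s)) → (a : AbelardChoice C ψ) (e : EloiseChoice C ψ) →
           Maybe (Occurs (successor C ψ s a e))
  extend nothing a e = nothing
  extend {ψ} {s} (just o) a e with ≟-EloiseChoice ψ (proj₁ (respond o a)) e
  ... | yes eq = just (subst (λ e → Occurs (successor C ψ s a e)) eq (proj₂ (respond o a)))
  ... | no _   = nothing

  extend-answer : ∀ {ψ s} (o : Occurs (ψ , s)) (a : AbelardChoice C ψ) →
                  ∃[ o′ ] extend (just o) a (answer (just o) a) ≡ just o′
  extend-answer {ψ} o a with ≟-EloiseChoice ψ (proj₁ (respond o a)) (proj₁ (respond o a))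
  ... | yes _ = _ , refl
  ... | no ≢  = contradiction refl ≢

  track : ∀ {p} → G.History p → Maybe (Occurs p)
  track G.start          = just (0 , here refl)
  track (G.move h _ a e) = extend (track h) a e

  strategy : G.EloiseStrategy
  strategy h = answer (track h)

  -- The comparison in `extend` succeeds at every move, since `strategy` and `extend` consult the
  -- same `respond`.
  track-follows : ∀ {p} {h : G.History p} → G.Follows strategy h → ∃[ o ] track h ≡ just o
  track-follows G.start = _ , refl
  track-follows (G.move {h = h} f _ a) with track h | track-follows f
  ... | .(just o) | o , refl = extend-answer o a

  winning : Sentence φ → Winning τ → G.Winning strategy
  winning sentence win {ℓ} h f with proj₁ (track-follows f) | covers-history model sentence h
  winning sentence win {pos (R · xs)} {s} h f | n , p∈ | cov with sends-total s xs cov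
  -- The occurrence of the literal itself witnesses the relation.
  ... | as , sends = as , sends , n , xs , s , p∈ , sends
  winning sentence win {neg (R · ys)} {s} h f | n , p∈ | cov with sends-total s ys cov
  ... | as , sends = as , sends , λ where
    (m , xs , s′ , q∈ , sends′) → win (play τ) (eloiseFollows τ)
      -- Positions only grow, so stage `n + m` contains both the positive literal from stage `m` and
      -- the negative one from stage `n`, and both send their variables to `as`.
      (n + m , R , xs , ys , s′ , s , as ,
       position-+ τ n q∈ ,
       subst (λ k → (lit (neg (R · ys)) , s) ∈ position (play τ) k) (ℕ.+-comm m n) (position-+ τ m p∈) ,
       sends′ , sends)

theorem3 : (V : Vocabulary) (φ : Formula V) → Sentence φ →
    let module MEG = ModelExistenceGame φ
        module G (M : Structure V) = EvaluationGame M φ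
    in
    Σ[ σ₀ ∈ MEG.AbelardStrategy ]
    Σ[ M ∈ (MEG.EloiseStrategy → Structure V) ]
    Σ[ Ψ ∈ ((τ : MEG.EloiseStrategy) → G.EloiseStrategy (M τ)) ]
      MEG.Enumeration σ₀ ×
      ((τ : MEG.EloiseStrategy) →
        MEG.UniquelyDeterminedBy (MEG.playOf σ₀ τ) (M τ) ×
        (MEG.Winning τ → G.Winning (M τ) (Ψ τ)))
theorem3 V φ sentence =
  enumerationStrategy , model , (λ τ → strategy τ) , enumeration ,
  λ τ → (determined τ , determined-unique τ) , winning τ sentence
  where
  open EnumerationStrategy φ
  open HintikkaModel φ
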